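{- Let $G=(V,E)$ be a directed graph with $V=\{1,\dots,N\}$ and $E\subseteq V^2$ (self-loops allowed), with adjacency matrix $\mathsf A$. Let $\mathsf H$ be the Hamiltonian path counting matrix of $G$ and let $\mathcal D$ be the set of weakly connected dominating sets in $G$. Then $$\mathsf H=\sum_{D\in\mathcal D}(-1)^{N-|D|}\Big(\mathsf A_D^{N-1}+\frac{\operatorname{Tr}(\mathsf A_D^{N})}{N}\,\mathsf I\Big).$$
   Context: The adjacency matrix $\mathsf A$ is the $N\times N$ matrix with $\mathsf A_{ij}=1$ if $(i,j)\in E$ and $0$ otherwise. $\mathsf I$ is the $N\times N$ identity matrix and $\operatorname{Tr}$ is the trace. For a non-empty $S\subseteq V$, $\mathsf A_S$ is the $N\times N$ matrix with $(\mathsf A_S)_{ij}=\mathsf A_{ij}$ if $i,j\in S$ and $0$ otherwise; $\mathsf A_D^{k}$ denotes the $k$-th power of $\mathsf A_D$. The matrix $\mathsf H$ is the $N\times N$ matrix whose $(i,j)$-entry is the number of Hamiltonian paths from $i$ to $j$: for $i\ne j$, the number of directed simple paths from $i$ to $j$ visiting every vertex of $G$ exactly once (length $N-1$); for $i=j$, the number of directed simple cycles starting and ending at $i$ and visiting every vertex of $G$ (length $N$), with orientation taken into account. Simple paths and cycles are non-empty. A digraph is weakly connected if replacing all its directed edges by undirected edges produces a connected undirected graph. For a non-empty $C\subseteq V$ inducing a weakly connected subgraph, the weak neighborhood is $N(C)=\{i\in V\setminus C:\ \exists j\in C,\ (i,j)\in E\text{ and/or }(j,i)\in E\}$. A weakly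 connected dominating set is a non-empty $D\subseteq V$ such that the subgraph of $G$ induced by $D$ is weakly connected and $|D|+|N(D)|=N$, i.e. $D\cup N(D)=V$.
   Formalization: The formal theorem assumes N ≥ 2: for N = 1 the formula always fails, since the right side is 1 + A_11 (because A_D^0 = I), while H_11 = A_11 counts only the self-loop. -}

module Defs where

open import Data.Bool.Base using (Bool; true; false; _∧_; if_then_else_)
open import Data.Fin.Base using (Fin)
open import Data.Fin.Properties using (_≟_; all?; any?)
open import Data.Fin.Subset using (Subset; Nonempty; ∣_∣; _∈_; _∉_)
open import Data.Fin.Subset.Properties using (_∈?_; nonempty?)
open import Data.Integer.Base using (+_)
open import Data.List.Base as List
  using (List; []; _∷_; allFin; cartesianProductWith; filter; foldr; length)
open import Data.List.Membership.Propositional using () renaming (_∈_ to _∈ˡ_)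
open import Data.List.Membership.Propositional.Properties using (∈-allFin)
open import Data.List.Relation.Unary.Any using (here; there)
open import Data.Nat.Base as ℕ using (ℕ; zero; suc; _∸_)
import Data.Nat.Properties as ℕ
open import Data.Product.Base using (∃; _×_; _,_)
open import Data.Rational.Base as ℚ using (ℚ; 0ℚ; 1ℚ; _/_)
open import Data.Sum.Base using (_⊎_; inj₁; inj₂)
open import Data.Vec.Base as Vec using (Vec; []; _∷_; head; last; tail)
import Data.Vec.Membership.DecPropositional as DecMembership
open import Data.Vec.Membership.Propositional using () renaming (_∈_ to _∈ᵛ_)
open import Data.Vec.Relation.Unary.AllPairs using (allPairs?)
open import Data.Vec.Relation.Unary.Linked using (Linked; linked?)
open import Data.Vec.Relation.Unary.Unique.Propositional using (Unique)
open import Level using (0ℓ)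
open import Relation.Binary.Construct.Closure.Equivalence using (EqClosure)
open import Relation.Binary.Construct.Closure.ReflexiveTransitive
  using (Star; ε; _◅_; _◅◅_)
open import Relation.Binary.Construct.Closure.Symmetric
  using (SymClosure; fwd; bwd)
open import Relation.Binary.Core using (Rel)
import Relation.Binary.Definitions as B
open import Relation.Binary.PropositionalEquality.Core using (_≡_; refl)
open import Relation.Nullary.Decidable
  using (Dec; does; yes; no; map′; ¬?; _×-dec_; _⊎-dec_; _→-dec_)
import Relation.Unary as U

open import Algebra.Definitions.RawSemiring ℚ.+-*-rawSemiring public
  using (_^_; sum)

Matrix : ℕ → Set
Matrix N = Fin N → Fin N → ℚ

module _ {N : ℕ} where

  infixl 6 _+ᴹ_
  infixl 7 _*ᴹ_ _·ᴹ_
  infixr 8 _^ᴹ_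

  0ᴹ : Matrix N
  0ᴹ i j = 0ℚ

  I : Matrix N
  I i j = if does (i ≟ j) then 1ℚ else 0ℚ

  _+ᴹ_ : Matrix N → Matrix N → Matrix N
  (A +ᴹ B) i j = A i j ℚ.+ B i j

  _·ᴹ_ : ℚ → Matrix N → Matrix N
  (c ·ᴹ A) i j = c ℚ.* A i j

  _*ᴹ_ : Matrix N → Matrix N → Matrix N
  (A *ᴹ B) i j = sum (λ k → A i k ℚ.* B k j)

  _^ᴹ_ : Matrix N → ℕ → Matrix N
  A ^ᴹ zero  = I
  A ^ᴹ suc k = A *ᴹ (A ^ᴹ k)

  Tr : Matrix N → ℚ
  Tr A = sum (λ i → A i i)

  Σᴹ : ∀ {X : Set} → List X → (X → Matrix N) → Matrix N
  Σᴹ xs f = foldr _+ᴹ_ 0ᴹ (List.map f xs)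

  infix 5 Σᴹ
  syntax Σᴹ xs (λ x → M) = Σᴹ[ x ∈ xs ] M

-- If xs lists every element of X exactly once, then vectors xs k lists
-- every element of Vec X k exactly once.
vectors : ∀ {X : Set} → List X → (k : ℕ) → List (Vec X k)
vectors xs zero    = [] ∷ []
vectors xs (suc k) = cartesianProductWith _∷_ xs (vectors xs k)

subsets : (N : ℕ) → List (Subset N)
subsets = vectors (true ∷ false ∷ [])

-- Decidability of reachability on a finite set (Warshall's algorithm):
-- Via xs relates i and j when j can be reached from i in one or more
-- steps with all intermediate points taken from xs.
module Reachability {N : ℕ} {R : Rel (Fin N) 0ℓ} (R? : B.Decidable R) where

  Via : List (Fin N) → Rel (Fin N) 0ℓ
  Via []       i j = R i j
  Via (x ∷ xs) i j = Via xs i j ⊎ (Via xs i x × Via xs x j)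

  via? : ∀ xs → B.Decidable (Via xs)
  via? []       i j = R? i j
  via? (x ∷ xs) i j = via? xs i j ⊎-dec (via? xs i x ×-dec via? xs x j)

  via⇒star : ∀ xs {i j} → Via xs i j → Star R i j
  via⇒star []       r              = r ◅ ε
  via⇒star (x ∷ xs) (inj₁ p)       = via⇒star xs p
  via⇒star (x ∷ xs) (inj₂ (p , q)) = via⇒star xs p ◅◅ via⇒star xs q

  edge⇒via : ∀ xs {i j} → R i j → Via xs i j
  edge⇒via []       r = r
  edge⇒via (x ∷ xs) r = inj₁ (edge⇒via xs r)

  via-trans : ∀ {xs x i j} → x ∈ˡ xs → Via xs i x → Via xs x j → Via xs i j
  via-trans (here refl) (inj₁ p)       (inj₁ q)       = inj₂ (p , q)
  via-trans (here refl) (inj₁ p)       (inj₂ (_ , q)) = inj₂ (p , q)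
  via-trans (here refl) (inj₂ (p , _)) (inj₁ q)       = inj₂ (p , q)
  via-trans (here refl) (inj₂ (p , _)) (inj₂ (_ , q)) = inj₂ (p , q)
  via-trans (there m)   (inj₁ p)       (inj₁ q)       = inj₁ (via-trans m p q)
  via-trans (there m)   (inj₁ p)       (inj₂ (q , r)) = inj₂ (via-trans m p q , r)
  via-trans (there m)   (inj₂ (p , q)) (inj₁ r)       = inj₂ (p , via-trans m q r)
  via-trans (there m)   (inj₂ (p , _)) (inj₂ (_ , q)) = inj₂ (p , q)

  star⇒via : ∀ {i j} → Star R i j → i ≡ j ⊎ Via (allFin N) i j
  star⇒via ε = inj₁ refl
  star⇒via (_◅_ {j = k} r rs) with star⇒via rs
  ... | inj₁ refl = inj₂ (edge⇒via (allFin N) r)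
  ... | inj₂ p    = inj₂ (via-trans (∈-allFin k) (edge⇒via (allFin N) r) p)

  star? : B.Decidable (Star R)
  star? i j = map′
    (λ { (inj₁ refl) → ε ; (inj₂ p) → via⇒star (allFin N) p })
    star⇒via
    (i ≟ j ⊎-dec via? (allFin N) i j)

symClosure? : ∀ {N} {R : Rel (Fin N) 0ℓ} →
              B.Decidable R → B.Decidable (SymClosure R)
symClosure? R? i j = map′
  (λ { (inj₁ r) → fwd r ; (inj₂ r) → bwd r })
  (λ { (fwd r) → inj₁ r ; (bwd r) → inj₂ r })
  (R? i j ⊎-dec R? j i)

record Digraph (N : ℕ) : Set₁ where
  field
    Edge  : Rel (Fin N) 0ℓ
    edge? : B.Decidable Edge

module _ {N : ℕ} (G : Digraph N) where

  open Digraph G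

  adjacency : Matrix N
  adjacency i j = if does (edge? i j) then 1ℚ else 0ℚ

  adjacencyOn : Subset N → Matrix N
  adjacencyOn S i j =
    if does (i ∈? S) ∧ does (j ∈? S) then adjacency i j else 0ℚ

  -- A walk of length ℓ is given by the sequence of its ℓ + 1 vertices.
  IsWalk : ∀ {ℓ} → Fin N → Fin N → Vec (Fin N) (suc ℓ) → Set
  IsWalk i j w = head w ≡ i × last w ≡ j × Linked Edge w

  VisitsAll : ∀ {k} → Vec (Fin N) k → Set
  VisitsAll w = ∀ v → v ∈ᵛ w

  IsHamiltonianPath : ∀ {ℓ} → Fin N → Fin N → Vec (Fin N) (suc ℓ) → Set
  IsHamiltonianPath i j w = IsWalk i j w × Unique w × VisitsAll w

  -- In a simple cycle only the first and last vertices coincide, so its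
  -- vertices are distinct once the first entry is dropped.
  IsHamiltonianCycle : ∀ {ℓ} → Fin N → Vec (Fin N) (suc ℓ) → Set
  IsHamiltonianCycle i w = IsWalk i i w × Unique (tail w) × VisitsAll w

  isWalk? : ∀ {ℓ} i j → U.Decidable (IsWalk {ℓ} i j)
  isWalk? i j w = head w ≟ i ×-dec last w ≟ j ×-dec linked? edge? w

  unique? : ∀ {k} → U.Decidable (Unique {A = Fin N} {k})
  unique? = allPairs? (λ u v → ¬? (u ≟ v))

  visitsAll? : ∀ {k} → U.Decidable (VisitsAll {k})
  visitsAll? w = all? (λ v → DecMembership._∈?_ _≟_ v w)

  isHamiltonianPath? : ∀ {ℓ} i j → U.Decidable (IsHamiltonianPath {ℓ} i j)
  isHamiltonianPath? i j w = isWalk? i j w ×-dec unique? w ×-dec visitsAll? w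

  isHamiltonianCycle? : ∀ {ℓ} i → U.Decidable (IsHamiltonianCycle {ℓ} i)
  isHamiltonianCycle? i w =
    isWalk? i i w ×-dec unique? (tail w) ×-dec visitsAll? w

  #hamiltonianPaths : Fin N → Fin N → ℕ
  #hamiltonianPaths i j =
    length (filter (isHamiltonianPath? i j) (vectors (allFin N) (suc (N ∸ 1))))

  #hamiltonianCycles : Fin N → ℕ
  #hamiltonianCycles i =
    length (filter (isHamiltonianCycle? i) (vectors (allFin N) (suc N)))

  -- For N = 1 the diagonal entry counts the self-loop only: the empty path,
  -- counted by A ^ᴹ 0 = I, is not a simple cycle.
  H : Matrix N
  H i j = + (if does (i ≟ j) then #hamiltonianCycles i
                             else #hamiltonianPaths i j) / 1

  InducedEdge : Subset N → Rel (Fin N) 0ℓ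
  InducedEdge S i j = i ∈ S × j ∈ S × Edge i j

  inducedEdge? : ∀ S → B.Decidable (InducedEdge S)
  inducedEdge? S i j = i ∈? S ×-dec j ∈? S ×-dec edge? i j

  -- EqClosure lets the edges of the induced subgraph be traversed in either
  -- direction.
  WeaklyConnected : Subset N → Set
  WeaklyConnected S = ∀ i j → i ∈ S → j ∈ S → EqClosure (InducedEdge S) i j

  weaklyConnected? : U.Decidable WeaklyConnected
  weaklyConnected? S = all? λ i → all? λ j →
    i ∈? S →-dec (j ∈? S →-dec
      Reachability.star? (symClosure? (inducedEdge? S)) i j)

  IsWeakNeighbor : Subset N → Fin N → Set
  IsWeakNeighbor C i = i ∉ C × ∃ λ j → j ∈ C × SymClosure Edge i j

  isWeakNeighbor? : ∀ C → U.Decidable (IsWeakNeighbor C)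
  isWeakNeighbor? C i =
    ¬? (i ∈? C) ×-dec any? (λ j → j ∈? C ×-dec symClosure? edge? i j)

  weakNeighborhood : Subset N → Subset N
  weakNeighborhood C = Vec.tabulate (λ i → does (isWeakNeighbor? C i))

  IsWeaklyConnectedDominating : Subset N → Set
  IsWeaklyConnectedDominating D =
    Nonempty D × WeaklyConnected D × ∣ D ∣ ℕ.+ ∣ weakNeighborhood D ∣ ≡ N

  isWeaklyConnectedDominating? : U.Decidable IsWeaklyConnectedDominating
  isWeaklyConnectedDominating? D =
    nonempty? D ×-dec weaklyConnected? D ×-dec
    (∣ D ∣ ℕ.+ ∣ weakNeighborhood D ∣) ℕ.≟ N

  weaklyConnectedDominatingSets : List (Subset N)
  weaklyConnectedDominatingSets =
    filter isWeaklyConnectedDominating? (subsets N)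

{-# OPTIONS --safe #-}

-- Expand the matrix powers into walks and exchange the two sums: a walk with
-- vertex set C, which is weakly connected, is counted with weight
-- ∑ (-1)^(N ∸ ∣ D ∣) over the weakly connected dominating sets D ⊇ C. This
-- weight is 1 if C = V and 0 otherwise; for the induction one also bounds D
-- from above, by a set B whose complement is dominated by C, and branches on
-- whether D contains a given neighbour of C in B. What survives is the walks
-- visiting every vertex. Such a walk of length N ∸ 1 is a Hamiltonian path,
-- hence not closed as N ≥ 2. The closed ones of length N are the Hamiltonian
-- cycles, and rotating the cycles shows that each vertex is the base point of
-- one N-th of them.
module Submission where

open import Defs
open import Algebra.Bundles using (CommutativeMonoid)
open import Data.Bool.Base using (true; false; if_then_else_)
import Data.Bool.Properties as Bool
open import Data.Fin.Base using (Fin; zero; suc; inject₁; fromℕ)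
open import Data.Fin.Induction using (<-weakInduction)
open import Data.Fin.Properties using (_≟_; any?)
open import Data.Fin.Subset
  using (Subset; inside; outside; _∈_; _∉_; _⊆_; ⊥; ⊤; ⁅_⁆; _∪_; _-_; ∁; ∣_∣; Nonempty)
open import Data.Fin.Subset.Properties
open import Data.Integer.Base as ℤ using (+_)
import Data.Integer.Properties as ℤ
open import Data.List.Base as List
  using (List; []; _∷_; _++_; allFin; cartesianProductWith; filter; length)
open import Data.Nat.Base as ℕ using (ℕ; zero; suc; NonZero; _∸_; _≤_; s≤s)
import Data.Nat.Properties as ℕ
open import Data.Product.Base using (∃; _×_; _,_; proj₁; proj₂)
open import Data.Rational.Base using (ℚ; 0ℚ; 1ℚ; -_; _+_; _*_; _/_; toℚᵘ)
import Data.Rational.Properties as ℚ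
open import Data.Rational.Unnormalised.Base as ℚᵘ using (mkℚᵘ; *≡*)
import Data.Rational.Unnormalised.Properties as ℚᵘ
open import Data.Sum.Base using (inj₁; inj₂)
open import Data.Vec.Base
  using (Vec; []; _∷_; _∷ʳ_; head; last; tail; lookup; here; there)
open import Data.Vec.Membership.Propositional using () renaming (_∈_ to _∈ᵛ_)
open import Data.Vec.Membership.Propositional.Properties using (∈-lookup)
open import Data.Vec.Properties
  using (≡-dec; lookup∘tabulate; []=⇒lookup; lookup⇒[]=; last-∷ʳ)
open import Data.Vec.Relation.Unary.All as All using (All; []; _∷_)
open import Data.Vec.Relation.Unary.All.Properties using (lookup⁻)
open import Data.Vec.Relation.Unary.AllPairs using ([]; _∷_)
open import Data.Vec.Relation.Unary.Any as Any using (here; there)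
open import Data.Vec.Relation.Unary.Any.Properties using (lookup-index)
open import Data.Vec.Relation.Unary.Linked as Linked using (Linked; []; [-]; _∷_; linked?)
open import Data.Vec.Relation.Unary.Unique.Propositional using (Unique)
open import Data.Vec.Relation.Unary.Unique.Propositional.Properties using (lookup-injective)
open import Function.Base using (_∘_; id)
open import Function.Bundles using (_⇔_; mk⇔; module Equivalence)
open import Level using (0ℓ)
open import Relation.Binary.Construct.Closure.Equivalence as EqClosure using (EqClosure)
open import Relation.Binary.Construct.Closure.ReflexiveTransitive using (ε; _◅_; _◅◅_)
open import Relation.Binary.Construct.Closure.Symmetric as SymClosure
  using (SymClosure; fwd; bwd)
open import Relation.Binary.Core using (Rel)
open import Relation.Binary.PropositionalEquality
  using (_≡_; _≢_; refl; sym; trans; cong; cong₂; subst; module ≡-Reasoning)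
open import Relation.Nullary.Decidable
  using (Dec; yes; no; does; dec-true; dec-false; does-⇔; _×-dec_; ¬?)
open import Relation.Nullary.Negation using (¬_; contradiction)
open import Relation.Unary using (Pred; Decidable)

open import Algebra.Properties.CommutativeSemigroup
  (CommutativeMonoid.commutativeSemigroup ℚ.+-0-commutativeMonoid)
  using () renaming (interchange to +-interchange)
open import Algebra.Properties.CommutativeSemigroup
  (CommutativeMonoid.commutativeSemigroup ℚ.*-1-commutativeMonoid)
  using () renaming (x∙yz≈y∙xz to *-swapˡ)

open ≡-Reasoning

private variable
  X Y P Q : Set
  n k : ℕ
  p q : Subset n
  x : Fin n

-- Indicators and finite sums

𝟙 : Dec P → ℚ
𝟙 p? = if does p? then 1ℚ else 0ℚ

𝟙-true : (p? : Dec P) → P → 𝟙 p? ≡ 1ℚ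
𝟙-true p? p = cong (if_then 1ℚ else 0ℚ) (dec-true p? p)

𝟙-false : (p? : Dec P) → ¬ P → 𝟙 p? ≡ 0ℚ
𝟙-false p? ¬p = cong (if_then 1ℚ else 0ℚ) (dec-false p? ¬p)

𝟙-cong : (p? : Dec P) (q? : Dec Q) → (P → Q) → (Q → P) → 𝟙 p? ≡ 𝟙 q?
𝟙-cong p? q? to from = cong (if_then 1ℚ else 0ℚ) (does-⇔ (mk⇔ to from) p? q?)

𝟙-× : (p? : Dec P) (q? : Dec Q) → 𝟙 (p? ×-dec q?) ≡ 𝟙 p? * 𝟙 q?
𝟙-× p? q? with does p?
... | true  = sym (ℚ.*-identityˡ (𝟙 q?))
... | false = sym (ℚ.*-zeroˡ (𝟙 q?))

-- Where the indicator vanishes both products are zero, so `a` and `b` may be compared under the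
-- assumption `P`. This lets a weight be evaluated only on vectors already known to be walks or
-- tours.
𝟙-*-cong : ∀ {P : Set} (p? : Dec P) {a b} → (P → a ≡ b) → 𝟙 p? * a ≡ 𝟙 p? * b
𝟙-*-cong (yes p) a≡b = cong (1ℚ *_) (a≡b p)
𝟙-*-cong (no ¬p) {a} {b} a≡b = trans (ℚ.*-zeroˡ a) (sym (ℚ.*-zeroˡ b))

∑ : List X → (X → ℚ) → ℚ
∑ []       f = 0ℚ
∑ (x ∷ xs) f = f x + ∑ xs f

∑-cong : ∀ (xs : List X) {f g : X → ℚ} → (∀ x → f x ≡ g x) → ∑ xs f ≡ ∑ xs g
∑-cong []       f≗g = refl
∑-cong (x ∷ xs) f≗g = cong₂ _+_ (f≗g x) (∑-cong xs f≗g)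

∑-zero : ∀ (xs : List X) {f : X → ℚ} → (∀ x → f x ≡ 0ℚ) → ∑ xs f ≡ 0ℚ
∑-zero []       f≗0 = refl
∑-zero (x ∷ xs) f≗0 = cong₂ _+_ (f≗0 x) (∑-zero xs f≗0)

∑-+ : ∀ (xs : List X) (f g : X → ℚ) → ∑ xs (λ x → f x + g x) ≡ ∑ xs f + ∑ xs g
∑-+ []       f g = refl
∑-+ (x ∷ xs) f g = trans (cong (_+_ (f x + g x)) (∑-+ xs f g)) (+-interchange (f x) (g x) _ _)

∑-*ˡ : ∀ (xs : List X) c (f : X → ℚ) → ∑ xs (λ x → c * f x) ≡ c * ∑ xs f
∑-*ˡ []       c f = sym (ℚ.*-zeroʳ c)
∑-*ˡ (x ∷ xs) c f = trans (cong (_+_ (c * f x)) (∑-*ˡ xs c f)) (sym (ℚ.*-distribˡ-+ c (f x) (∑ xs f)))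

∑-*ʳ : ∀ (xs : List X) (f : X → ℚ) c → ∑ xs (λ x → f x * c) ≡ ∑ xs f * c
∑-*ʳ []       f c = sym (ℚ.*-zeroˡ c)
∑-*ʳ (x ∷ xs) f c = trans (cong (_+_ (f x * c)) (∑-*ʳ xs f c)) (sym (ℚ.*-distribʳ-+ c (f x) (∑ xs f)))

∑-swap : ∀ (xs : List X) (ys : List Y) (f : X → Y → ℚ) →
         ∑ xs (λ x → ∑ ys (f x)) ≡ ∑ ys (λ y → ∑ xs (λ x → f x y))
∑-swap []       ys f = sym (∑-zero ys (λ _ → refl))
∑-swap (x ∷ xs) ys f = trans (cong (_+_ (∑ ys (f x))) (∑-swap xs ys f)) (sym (∑-+ ys (f x) _))

∑-++ : ∀ (xs ys : List X) (f : X → ℚ) → ∑ (xs ++ ys) f ≡ ∑ xs f + ∑ ys f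
∑-++ []       ys f = sym (ℚ.+-identityˡ _)
∑-++ (x ∷ xs) ys f = trans (cong (_+_ (f x)) (∑-++ xs ys f)) (sym (ℚ.+-assoc (f x) _ _))

∑-map : ∀ (g : X → Y) xs (f : Y → ℚ) → ∑ (List.map g xs) f ≡ ∑ xs (f ∘ g)
∑-map g []       f = refl
∑-map g (x ∷ xs) f = cong (_+_ (f (g x))) (∑-map g xs f)

∑-filter : ∀ {P : Pred X 0ℓ} (P? : Decidable P) xs (f : X → ℚ) →
           ∑ (filter P? xs) f ≡ ∑ xs (λ x → 𝟙 (P? x) * f x)
∑-filter P? []       f = refl
∑-filter P? (x ∷ xs) f with does (P? x)
... | true  = cong₂ _+_ (sym (ℚ.*-identityˡ (f x))) (∑-filter P? xs f)
... | false = trans (∑-filter P? xs f) (sym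
  (trans (cong (_+ _) (ℚ.*-zeroˡ (f x))) (ℚ.+-identityˡ _)))

-- Sums over vectors, vertices and subsets

∑-vectors : ∀ (xs : List X) k (f : Vec X (suc k) → ℚ) →
            ∑ (vectors xs (suc k)) f ≡ ∑ xs (λ x → ∑ (vectors xs k) (λ v → f (x ∷ v)))
∑-vectors {X = X} xs k f = go xs
  where
  vs = vectors xs k
  go : ∀ ys → ∑ (cartesianProductWith _∷_ ys vs) f ≡ ∑ ys (λ x → ∑ vs (λ v → f (x ∷ v)))
  go []       = refl
  go (y ∷ ys) = trans (∑-++ (List.map (y ∷_) vs) _ f)
    (cong₂ _+_ (∑-map (y ∷_) vs f) (go ys))

-- `vectors` is built from the first entry; exchanging sums carries the last entry outwards past it.
-- Together with `∑-vectors` this makes such sums invariant under rotation of the vector.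
∑-vectors-∷ʳ : ∀ (xs : List X) k (f : Vec X (suc k) → ℚ) →
               ∑ (vectors xs (suc k)) f ≡ ∑ xs (λ x → ∑ (vectors xs k) (λ v → f (v ∷ʳ x)))
∑-vectors-∷ʳ xs zero    f = ∑-vectors xs zero f
∑-vectors-∷ʳ xs (suc k) f = begin
  ∑ (vectors xs (suc (suc k))) f
    ≡⟨ ∑-vectors xs (suc k) f ⟩
  ∑ xs (λ y → ∑ (vectors xs (suc k)) (λ v → f (y ∷ v)))
    ≡⟨ ∑-cong xs (λ y → ∑-vectors-∷ʳ xs k (λ v → f (y ∷ v))) ⟩
  ∑ xs (λ y → ∑ xs (λ x → ∑ (vectors xs k) (λ v → f (y ∷ (v ∷ʳ x)))))
    ≡⟨ ∑-swap xs xs _ ⟩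
  ∑ xs (λ x → ∑ xs (λ y → ∑ (vectors xs k) (λ v → f (y ∷ (v ∷ʳ x)))))
    ≡⟨ ∑-cong xs (λ x → ∑-vectors xs k (λ v → f (v ∷ʳ x))) ⟨
  ∑ xs (λ x → ∑ (vectors xs (suc k)) (λ v → f (v ∷ʳ x))) ∎

-- Matrix products and traces are written with `sum`, while the exchange lemmas concern sums over
-- lists.
∑-allFin : (f : Fin n → ℚ) → ∑ (allFin n) f ≡ sum f
∑-allFin f = go id f
  where
  -- The tail of `allFin (suc n)` tabulates `suc`, so the induction needs an arbitrary `g`.
  go : ∀ {m} (g : Fin m → X) (f : X → ℚ) → ∑ (List.tabulate g) f ≡ sum (f ∘ g)
  go {m = zero}  g f = refl
  go {m = suc m} g f = cong (_+_ (f (g zero))) (go (g ∘ suc) f)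

sum-cong : ∀ {n} {f g : Fin n → ℚ} → (∀ i → f i ≡ g i) → sum f ≡ sum g
sum-cong {n} {f} {g} f≗g = trans (sym (∑-allFin f)) (trans (∑-cong (allFin n) f≗g) (∑-allFin g))

sum-≟ : (i : Fin n) (f : Fin n → ℚ) → sum (λ x → 𝟙 (x ≟ i) * f x) ≡ f i
sum-≟ {n = suc n} zero f = begin
  1ℚ * f zero + sum (λ x → 0ℚ * f (suc x))
    ≡⟨ cong₂ _+_ (ℚ.*-identityˡ (f zero)) (sym (∑-allFin {n} (λ x → 0ℚ * f (suc x)))) ⟩
  f zero + ∑ (allFin n) (λ x → 0ℚ * f (suc x))
    ≡⟨ cong (_+_ (f zero)) (∑-zero (allFin n) (λ x → ℚ.*-zeroˡ (f (suc x)))) ⟩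
  f zero + 0ℚ
    ≡⟨ ℚ.+-identityʳ (f zero) ⟩
  f zero ∎
sum-≟ (suc i) f = trans (cong₂ _+_ (ℚ.*-zeroˡ (f zero)) (sum-≟ i (f ∘ suc))) (ℚ.+-identityˡ _)

∑-allFin-≟ : (i : Fin n) (f : Fin n → ℚ) → ∑ (allFin n) (λ x → 𝟙 (x ≟ i) * f x) ≡ f i
∑-allFin-≟ i f = trans (∑-allFin (λ x → 𝟙 (x ≟ i) * f x)) (sum-≟ i f)

-- Each subset is listed exactly once. A wrong first entry already makes the indicator compute to
-- `0ℚ`, so one of the two halves disappears at every stage.
∑-subsets-≟ : (C : Subset n) (f : Subset n → ℚ) →
              ∑ (subsets n) (λ D → 𝟙 (≡-dec Bool._≟_ D C) * f D) ≡ f C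
∑-subsets-≟ [] f = trans (ℚ.+-identityʳ (1ℚ * f [])) (ℚ.*-identityˡ (f []))
∑-subsets-≟ {n = suc n} (true ∷ C) f = begin
  ∑ (subsets (suc n)) (λ D → 𝟙 (≡-dec Bool._≟_ D (true ∷ C)) * f D)
    ≡⟨ ∑-vectors (true ∷ false ∷ []) n _ ⟩
  ∑ (subsets n) (λ D → 𝟙 (≡-dec Bool._≟_ D C) * f (true ∷ D)) +
    (∑ (subsets n) (λ D → 0ℚ * f (false ∷ D)) + 0ℚ)
    ≡⟨ cong₂ (λ x y → x + (y + 0ℚ)) (∑-subsets-≟ C (f ∘ (true ∷_)))
         (∑-zero (subsets n) (λ D → ℚ.*-zeroˡ (f (false ∷ D)))) ⟩
  f (true ∷ C) + 0ℚ
    ≡⟨ ℚ.+-identityʳ _ ⟩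
  f (true ∷ C) ∎
∑-subsets-≟ {n = suc n} (false ∷ C) f = begin
  ∑ (subsets (suc n)) (λ D → 𝟙 (≡-dec Bool._≟_ D (false ∷ C)) * f D)
    ≡⟨ ∑-vectors (true ∷ false ∷ []) n _ ⟩
  ∑ (subsets n) (λ D → 0ℚ * f (true ∷ D)) +
    (∑ (subsets n) (λ D → 𝟙 (≡-dec Bool._≟_ D C) * f (false ∷ D)) + 0ℚ)
    ≡⟨ cong₂ (λ x y → x + (y + 0ℚ)) (∑-zero (subsets n) (λ D → ℚ.*-zeroˡ (f (true ∷ D))))
         (∑-subsets-≟ C (f ∘ (false ∷_))) ⟩
  0ℚ + (f (false ∷ C) + 0ℚ)
    ≡⟨ trans (ℚ.+-identityˡ _) (ℚ.+-identityʳ _) ⟩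
  f (false ∷ C) ∎

-- Counts and reciprocals as rationals

suc/1 : ∀ n → + suc n / 1 ≡ 1ℚ + (+ n / 1)
-- The fraction `+ n / 1` is reduced by a gcd that is stuck on a variable `n`, so the comparison is
-- made between unnormalised fractions.
suc/1 n = ℚ.toℚᵘ-injective (begin′
  toℚᵘ (+ suc n / 1)              ≈⟨ ℚ.toℚᵘ-fromℚᵘ (mkℚᵘ (+ suc n) 0) ⟩
  mkℚᵘ (+ suc n) 0                ≈⟨ *≡* (cong (λ m → (+ 1 ℤ.+ m) ℤ.* + 1) (sym (ℤ.*-identityʳ (+ n)))) ⟩
  ℚᵘ.1ℚᵘ ℚᵘ.+ mkℚᵘ (+ n) 0        ≈⟨ ℚᵘ.+-congʳ ℚᵘ.1ℚᵘ (ℚ.toℚᵘ-fromℚᵘ (mkℚᵘ (+ n) 0)) ⟨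
  ℚᵘ.1ℚᵘ ℚᵘ.+ toℚᵘ (+ n / 1)      ≈⟨ ℚ.toℚᵘ-homo-+ 1ℚ (+ n / 1) ⟨
  toℚᵘ (1ℚ + (+ n / 1))           ∎′)
  where
  open ℚᵘ.≃-Reasoning renaming (begin_ to begin′_; _∎ to _∎′)

length-filter : ∀ {P : Pred X 0ℓ} (P? : Decidable P) xs →
                + length (filter P? xs) / 1 ≡ ∑ xs (λ x → 𝟙 (P? x))
length-filter P? []       = refl
length-filter P? (x ∷ xs) with does (P? x)
... | true  = trans (suc/1 (length (filter P? xs))) (cong (_+_ 1ℚ) (length-filter P? xs))
... | false = trans (length-filter P? xs) (sym (ℚ.+-identityˡ _))

*-inverse-/ : ∀ n → (+ suc n / 1) * (+ 1 / suc n) ≡ 1ℚ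
*-inverse-/ n = ℚ.toℚᵘ-injective (begin′
  toℚᵘ ((+ suc n / 1) * (+ 1 / suc n))
    ≈⟨ ℚ.toℚᵘ-homo-* (+ suc n / 1) (+ 1 / suc n) ⟩
  toℚᵘ (+ suc n / 1) ℚᵘ.* toℚᵘ (+ 1 / suc n)
    ≈⟨ ℚᵘ.*-cong (ℚ.toℚᵘ-fromℚᵘ (mkℚᵘ (+ suc n) 0)) (ℚ.toℚᵘ-fromℚᵘ (mkℚᵘ (+ 1) n)) ⟩
  mkℚᵘ (+ suc n) 0 ℚᵘ.* mkℚᵘ (+ 1) n
    ≈⟨ ℚᵘ.*-inverseʳ (mkℚᵘ (+ suc n) 0) ⟩
  ℚᵘ.1ℚᵘ ∎′)
  where
  open ℚᵘ.≃-Reasoning renaming (begin_ to begin′_; _∎ to _∎′)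

∑-const : ∀ n c → ∑ (allFin n) (λ _ → c) ≡ (+ n / 1) * c
∑-const n c = trans (∑-allFin {n} (λ _ → c)) (go n)
  where
  go : ∀ n → sum {n} (λ _ → c) ≡ (+ n / 1) * c
  go zero    = sym (ℚ.*-zeroˡ c)
  go (suc n) = begin
    c + sum {n} (λ _ → c)       ≡⟨ cong₂ _+_ (sym (ℚ.*-identityˡ c)) (go n) ⟩
    1ℚ * c + (+ n / 1) * c      ≡⟨ ℚ.*-distribʳ-+ c 1ℚ (+ n / 1) ⟨
    (1ℚ + (+ n / 1)) * c        ≡⟨ cong (_* c) (suc/1 n) ⟨
    (+ suc n / 1) * c           ∎

Σᴹ-∑ : ∀ {N} {X : Set} (xs : List X) (f : X → Matrix N) i j → Σᴹ xs f i j ≡ ∑ xs (λ x → f x i j)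
Σᴹ-∑ []       f i j = refl
Σᴹ-∑ (x ∷ xs) f i j = cong (_+_ (f x i j)) (Σᴹ-∑ xs f i j)

-- Walks and matrix powers

module _ {N : ℕ} where

  private
    vs : ∀ k → List (Vec (Fin N) k)
    vs = vectors (allFin N)

  -- Each further factor prepends a vertex and its outgoing edge. The matrix `A` is related to `G`
  -- pointwise because this is how `adjacencyOn G D` agrees with the adjacency matrix of the induced
  -- digraph.
  ^ᴹ-walks : (G : Digraph N) (A : Matrix N) → (∀ i j → A i j ≡ adjacency G i j) →
             ∀ k i j → (A ^ᴹ k) i j ≡ ∑ (vs (suc k)) (λ w → 𝟙 (isWalk? G i j w))
  ^ᴹ-walks G A A≗G zero i j = sym (begin
    ∑ (vs 1) (λ w → 𝟙 (isWalk? G i j w))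
      ≡⟨ ∑-vectors (allFin N) 0 _ ⟩
    ∑ (allFin N) (λ x → 𝟙 (isWalk? G i j (x ∷ [])) + 0ℚ)
      ≡⟨ ∑-cong (allFin N) (λ x → trans (ℚ.+-identityʳ (𝟙 (isWalk? G i j (x ∷ []))))
           (trans (𝟙-× (x ≟ i) (last-only? x))
             (cong (𝟙 (x ≟ i) *_) (𝟙-cong (last-only? x) (x ≟ j) (λ (p , _) → p) (λ p → p , [-]))))) ⟩
    ∑ (allFin N) (λ x → 𝟙 (x ≟ i) * 𝟙 (x ≟ j))
      ≡⟨ ∑-allFin-≟ i (λ x → 𝟙 (x ≟ j)) ⟩
    I i j ∎)
    where
    last-only? : (x : Fin N) → Dec (x ≡ j × Linked (Digraph.Edge G) (x ∷ []))
    last-only? x = x ≟ j ×-dec linked? (Digraph.edge? G) (x ∷ [])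
  ^ᴹ-walks G A A≗G (suc k) i j = begin
    sum (λ m → A i m * (A ^ᴹ k) m j)
      ≡⟨ sum-cong (λ m → cong₂ _*_ (A≗G i m) (^ᴹ-walks G A A≗G k m j)) ⟩
    sum (λ m → adjacency G i m * ∑ (vs (suc k)) (λ w → 𝟙 (isWalk? G m j w)))
      ≡⟨ ∑-allFin (λ m → adjacency G i m * ∑ (vs (suc k)) (λ w → 𝟙 (isWalk? G m j w))) ⟨
    ∑ (allFin N) (λ m → adjacency G i m * ∑ (vs (suc k)) (λ w → 𝟙 (isWalk? G m j w)))
      ≡⟨ ∑-cong (allFin N) (λ m → sym (∑-*ˡ (vs (suc k)) (adjacency G i m) _)) ⟩
    ∑ (allFin N) (λ m → ∑ (vs (suc k)) (λ w → adjacency G i m * 𝟙 (isWalk? G m j w)))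
      ≡⟨ ∑-swap (allFin N) (vs (suc k)) _ ⟩
    ∑ (vs (suc k)) (λ w → ∑ (allFin N) (λ m → adjacency G i m * 𝟙 (isWalk? G m j w)))
      -- The summation index `m` of the matrix product has to be the head of the remaining walk.
      ≡⟨ ∑-cong (vs (suc k)) (λ w → trans
           (∑-cong (allFin N) (λ m → first m w))
           (∑-allFin-≟ (head w) (λ m → adjacency G i m * 𝟙 (rest? w)))) ⟩
    ∑ (vs (suc k)) (λ w → adjacency G i (head w) * 𝟙 (rest? w))
      -- Read backwards, the delta sum turns the fixed start `i` into a summed first entry `x` of a
      -- longer vector.
      ≡⟨ ∑-allFin-≟ i (λ x → ∑ (vs (suc k)) (λ w → adjacency G x (head w) * 𝟙 (rest? w))) ⟨
    ∑ (allFin N) (λ x → 𝟙 (x ≟ i) * ∑ (vs (suc k)) (λ w → adjacency G x (head w) * 𝟙 (rest? w)))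
      ≡⟨ ∑-cong (allFin N) (λ x → trans (sym (∑-*ˡ (vs (suc k)) (𝟙 (x ≟ i)) _))
           (∑-cong (vs (suc k)) (λ w → sym (extend x w)))) ⟩
    ∑ (allFin N) (λ x → ∑ (vs (suc k)) (λ w → 𝟙 (isWalk? G i j (x ∷ w))))
      ≡⟨ ∑-vectors (allFin N) (suc k) _ ⟨
    ∑ (vs (suc (suc k))) (λ w → 𝟙 (isWalk? G i j w)) ∎
    where
    open Digraph G
    rest? : (w : Vec (Fin N) (suc k)) → Dec (last w ≡ j × Linked Edge w)
    rest? w = last w ≟ j ×-dec linked? edge? w

    first : ∀ m w → adjacency G i m * 𝟙 (isWalk? G m j w) ≡
                    𝟙 (m ≟ head w) * (adjacency G i m * 𝟙 (rest? w))
    first m w = begin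
      adjacency G i m * 𝟙 (isWalk? G m j w)
        ≡⟨ cong (adjacency G i m *_) (𝟙-× (head w ≟ m) (rest? w)) ⟩
      adjacency G i m * (𝟙 (head w ≟ m) * 𝟙 (rest? w))
        ≡⟨ *-swapˡ (adjacency G i m) (𝟙 (head w ≟ m)) (𝟙 (rest? w)) ⟩
      𝟙 (head w ≟ m) * (adjacency G i m * 𝟙 (rest? w))
        ≡⟨ cong (_* (adjacency G i m * 𝟙 (rest? w))) (𝟙-cong (head w ≟ m) (m ≟ head w) sym sym) ⟩
      𝟙 (m ≟ head w) * (adjacency G i m * 𝟙 (rest? w)) ∎

    extend : ∀ x w → 𝟙 (isWalk? G i j (x ∷ w)) ≡ 𝟙 (x ≟ i) * (adjacency G x (head w) * 𝟙 (rest? w))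
    extend x w = begin
      𝟙 (isWalk? G i j (x ∷ w))
        ≡⟨ 𝟙-× (x ≟ i) (last w ≟ j ×-dec linked? edge? (x ∷ w)) ⟩
      𝟙 (x ≟ i) * 𝟙 (last w ≟ j ×-dec linked? edge? (x ∷ w))
        ≡⟨ cong (𝟙 (x ≟ i) *_) (trans
             (𝟙-cong (last w ≟ j ×-dec linked? edge? (x ∷ w)) (edge? x (head w) ×-dec rest? w)
               (λ { (p , e ∷ q) → e , p , q }) (λ (e , p , q) → p , e ∷ q))
             (𝟙-× (edge? x (head w)) (rest? w))) ⟩
      𝟙 (x ≟ i) * (adjacency G x (head w) * 𝟙 (rest? w)) ∎

module _ {N : ℕ} (G : Digraph N) (D : Subset N) where

  open Digraph G

  -- All `N` vertices are kept, those outside `D` being isolated, so that the matrices keep their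
  -- size.
  induced : Digraph N
  induced = record { Edge = InducedEdge G D ; edge? = inducedEdge? G D }

  adjacencyOn-induced : ∀ i j → adjacencyOn G D i j ≡ adjacency induced i j
  adjacencyOn-induced i j with does (i ∈? D) | does (j ∈? D)
  ... | true  | true  = refl
  ... | true  | false = refl
  ... | false | _     = refl

  linked-induced⁺ : ∀ {k} {w : Vec (Fin N) k} → Linked Edge w → All (_∈ D) w → Linked (InducedEdge G D) w
  linked-induced⁺ [] _ = []
  linked-induced⁺ [-] _ = [-]
  linked-induced⁺ (e ∷ es) (px ∷ py ∷ ps) = (px , py , e) ∷ linked-induced⁺ es (py ∷ ps)

  -- Membership in `D` is read off the edges, hence the two vertices at least: a walk with a single
  -- vertex has no edge.
  linked-induced⁻ : ∀ {k} {w : Vec (Fin N) (suc (suc k))} → Linked (InducedEdge G D) w → All (_∈ D) w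
  linked-induced⁻ {w = x ∷ y ∷ []} ((px , py , _) ∷ _) = px ∷ py ∷ []
  linked-induced⁻ {w = x ∷ y ∷ _ ∷ _} ((px , _ , _) ∷ es) = px ∷ linked-induced⁻ es

  -- For exponent 0 this fails: A ^ᴹ 0 = I also counts the vertices outside D.
  adjacencyOn-^ᴹ : ∀ k i j → (adjacencyOn G D ^ᴹ suc k) i j ≡
    ∑ (vectors (allFin N) (suc (suc k))) (λ w → 𝟙 (isWalk? G i j w) * 𝟙 (All.all? (_∈? D) w))
  adjacencyOn-^ᴹ k i j = trans (^ᴹ-walks induced (adjacencyOn G D) adjacencyOn-induced (suc k) i j)
    (∑-cong (vectors (allFin N) (suc (suc k))) λ w → trans
      (𝟙-cong (isWalk? induced i j w) (isWalk? G i j w ×-dec All.all? (_∈? D) w)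
        (λ (p , q , es) → (p , q , Linked.map (λ (_ , _ , e) → e) es) , linked-induced⁻ es)
        (λ ((p , q , es) , d) → p , q , linked-induced⁺ es d))
      (𝟙-× (isWalk? G i j w) (All.all? (_∈? D) w)))

-- Alternating sums over weakly connected dominating sets

⊆∧≥⇒≡ : p ⊆ q → ∣ q ∣ ≤ ∣ p ∣ → p ≡ q
⊆∧≥⇒≡ {p = p} {q} p⊆q ∣q∣≤∣p∣ = ⊆-antisym p⊆q q⊆p
  where
  q⊆p : q ⊆ p
  q⊆p {x} x∈q with x ∈? p
  ... | yes x∈p = x∈p
  ... | no  x∉p = contradiction ∣q∣≤∣p∣ (ℕ.<⇒≱ (p⊂q⇒∣p∣<∣q∣ (p⊆q , x , x∈q , x∉p)))

∣p∪⁅x⁆∣ : (p : Subset n) → x ∉ p → ∣ p ∪ ⁅ x ⁆ ∣ ≡ suc ∣ p ∣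
∣p∪⁅x⁆∣ {x = zero}  (inside  ∷ p) x∉p = contradiction here x∉p
∣p∪⁅x⁆∣ {x = zero}  (outside ∷ p) x∉p = cong (suc ∘ ∣_∣) (∪-identityʳ p)
∣p∪⁅x⁆∣ {x = suc x} (inside  ∷ p) x∉p = cong suc (∣p∪⁅x⁆∣ p (x∉p ∘ there))
∣p∪⁅x⁆∣ {x = suc x} (outside ∷ p) x∉p = ∣p∪⁅x⁆∣ p (x∉p ∘ there)

suc∣p-x∣ : x ∈ p → suc ∣ p - x ∣ ≡ ∣ p ∣
suc∣p-x∣ {p = _ ∷ p} here = cong (suc ∘ ∣_∣) (p─⊥≡p p)
suc∣p-x∣ {p = inside  ∷ p} (there x∈p) = cong suc (suc∣p-x∣ x∈p)
suc∣p-x∣ {p = outside ∷ p} (there x∈p) = suc∣p-x∣ x∈p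

x∉p-x : (p : Subset n) (x : Fin n) → x ∉ p - x
x∉p-x (_ ∷ p) (suc x) (there x∈p-x) = x∉p-x p x x∈p-x

p∪⁅x⁆⊆q : p ⊆ q → x ∈ q → p ∪ ⁅ x ⁆ ⊆ q
p∪⁅x⁆⊆q {p = p} {x = x} p⊆q x∈q y∈ with x∈p∪q⁻ p ⁅ x ⁆ y∈
... | inj₁ y∈p = p⊆q y∈p
... | inj₂ y∈x with refl ← x∈⁅y⁆⇒x≡y x y∈x = x∈q

p⊆q-x : p ⊆ q → x ∉ p → p ⊆ q - x
p⊆q-x p⊆q x∉p y∈p = x∈p∧x≢y⇒x∈p-y (p⊆q y∈p) (λ { refl → x∉p y∈p })

x∈p∪⁅x⁆ : (p : Subset n) → x ∈ p ∪ ⁅ x ⁆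
x∈p∪⁅x⁆ p = q⊆p∪q p _ (x∈⁅x⁆ _)

-1^ : ℕ → ℚ
-1^ m = (- 1ℚ) ^ m

sgn : Subset n → ℚ
sgn {n} D = -1^ (n ∸ ∣ D ∣)

-1^suc+ : ∀ m → -1^ m + -1^ (suc m) ≡ 0ℚ
-1^suc+ m = begin
  -1^ m + (- 1ℚ) * -1^ m   ≡⟨ cong (_+_ (-1^ m)) (ℚ.neg-distribˡ-* 1ℚ (-1^ m)) ⟨
  -1^ m + - (1ℚ * -1^ m)   ≡⟨ cong (λ y → -1^ m + - y) (ℚ.*-identityˡ (-1^ m)) ⟩
  -1^ m + - (-1^ m)        ≡⟨ ℚ.+-inverseʳ (-1^ m) ⟩
  0ℚ                       ∎

module _ {N : ℕ} (G : Digraph N) where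

  open Digraph G

  private variable
    B C D : Subset N

  induce : ∀ {i j} → i ∈ C → j ∈ C → SymClosure Edge i j → SymClosure (InducedEdge G C) i j
  induce i∈C j∈C (fwd e) = fwd (i∈C , j∈C , e)
  induce i∈C j∈C (bwd e) = bwd (j∈C , i∈C , e)

  connected-mono : C ⊆ D → ∀ {i j} → EqClosure (InducedEdge G C) i j → EqClosure (InducedEdge G D) i j
  connected-mono C⊆D = EqClosure.map (λ (i∈C , j∈C , e) → C⊆D i∈C , C⊆D j∈C , e)

  rooted⇒connected : ∀ r → (∀ {i} → i ∈ C → EqClosure (InducedEdge G C) r i) → WeaklyConnected G C
  rooted⇒connected r path i j i∈C j∈C = EqClosure.symmetric _ (path i∈C) ◅◅ path j∈C

  -- `Dominates C C` is ordinary domination. The second set is separate so that the induction can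
  -- shrink the upper bound of an interval while `C` stays fixed.
  Dominates : Subset N → Subset N → Set
  Dominates C S = ∀ {v} → v ∉ S → ∃ λ j → j ∈ C × SymClosure Edge v j

  ∈-weakNeighborhood : ∀ {v} → v ∈ weakNeighborhood G C ⇔ IsWeakNeighbor G C v
  ∈-weakNeighborhood {C} {v} = mk⇔
    (λ v∈ → witness (isWeakNeighbor? G C v)
      (trans (sym (lookup∘tabulate _ v)) ([]=⇒lookup v∈)))
    (λ nb → lookup⇒[]= v _ (trans (lookup∘tabulate _ v) (dec-true (isWeakNeighbor? G C v) nb)))
    where
    witness : ∀ {P : Set} (p? : Dec P) → does p? ≡ true → P
    witness (yes p) _ = p

  weakNeighborhood⊆∁ : weakNeighborhood G C ⊆ ∁ C
  weakNeighborhood⊆∁ v∈ = x∉p⇒x∈∁p (proj₁ (Equivalence.to ∈-weakNeighborhood v∈))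

  -- The weak neighborhood lies in `∁ C`, and the cardinality condition gives both the same size, so
  -- they coincide.
  dominating⁻ : ∣ C ∣ ℕ.+ ∣ weakNeighborhood G C ∣ ≡ N → Dominates C C
  dominating⁻ {C} eq v∉C = proj₂ (Equivalence.to ∈-weakNeighborhood
    (subst (_ ∈_) (sym neighborhood≡∁) (x∉p⇒x∈∁p v∉C)))
    where
    neighborhood≡∁ : weakNeighborhood G C ≡ ∁ C
    neighborhood≡∁ = ⊆∧≥⇒≡ weakNeighborhood⊆∁ (ℕ.≤-reflexive (trans (∣∁p∣≡n∸∣p∣ C)
      (trans (cong (_∸ ∣ C ∣) (sym eq)) (ℕ.m+n∸m≡n ∣ C ∣ _))))

  dominating⁺ : Dominates C C → ∣ C ∣ ℕ.+ ∣ weakNeighborhood G C ∣ ≡ N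
  dominating⁺ {C} dom = begin
    ∣ C ∣ ℕ.+ ∣ weakNeighborhood G C ∣
      ≡⟨ cong (λ S → ∣ C ∣ ℕ.+ ∣ S ∣) (⊆-antisym weakNeighborhood⊆∁ λ v∈∁C →
           Equivalence.from ∈-weakNeighborhood (x∈∁p⇒x∉p v∈∁C , dom (x∈∁p⇒x∉p v∈∁C))) ⟩
    ∣ C ∣ ℕ.+ ∣ ∁ C ∣
      ≡⟨ cong (∣ C ∣ ℕ.+_) (∣∁p∣≡n∸∣p∣ C) ⟩
    ∣ C ∣ ℕ.+ (N ∸ ∣ C ∣)
      ≡⟨ ℕ.m+[n∸m]≡n (∣p∣≤n C) ⟩
    N ∎

  between? : ∀ C B D → Dec (C ⊆ D × D ⊆ B × IsWeaklyConnectedDominating G D)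
  between? C B D = C ⊆? D ×-dec D ⊆? B ×-dec isWeaklyConnectedDominating? G D

  ∑-between : Subset N → Subset N → ℚ
  ∑-between C B = ∑ (subsets N) (λ D → 𝟙 (between? C B D) * sgn D)

  ∑-between-≡ : IsWeaklyConnectedDominating G C → ∑-between C C ≡ sgn C
  ∑-between-≡ {C} wcd = trans
    (∑-cong (subsets N) λ D → cong (_* sgn D) (𝟙-cong
      (between? C C D) (≡-dec Bool._≟_ D C)
      (λ (C⊆D , D⊆C , _) → ⊆-antisym D⊆C C⊆D) (λ { refl → id , id , wcd })))
    (∑-subsets-≟ C sgn)

  -- The sets `D` of the interval are sorted by whether they contain `x`; exactly one of the two
  -- right-hand indicators can be non-zero for a given `D`.
  ∑-between-split : x ∉ C → x ∈ B → ∑-between C B ≡ ∑-between (C ∪ ⁅ x ⁆) B + ∑-between C (B - x)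
  ∑-between-split {x} {C} {B} x∉C x∈B = trans
    (∑-cong (subsets N) λ D → trans (cong (_* sgn D) (split D)) (ℚ.*-distribʳ-+ (sgn D)
      (𝟙 (between? (C ∪ ⁅ x ⁆) B D)) (𝟙 (between? C (B - x) D))))
    (∑-+ (subsets N) (λ D → 𝟙 (between? (C ∪ ⁅ x ⁆) B D) * sgn D) (λ D → 𝟙 (between? C (B - x) D) * sgn D))
    where
    split : ∀ D → 𝟙 (between? C B D) ≡ 𝟙 (between? (C ∪ ⁅ x ⁆) B D) + 𝟙 (between? C (B - x) D)
    split D with x ∈? D
    ... | yes x∈D = trans (sym (ℚ.+-identityʳ _)) (cong₂ _+_
      (𝟙-cong (between? C B D) (between? (C ∪ ⁅ x ⁆) B D)
        (λ (C⊆D , D⊆B , wcd) → p∪⁅x⁆⊆q C⊆D x∈D , D⊆B , wcd)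
        (λ (Cx⊆D , D⊆B , wcd) → Cx⊆D ∘ p⊆p∪q ⁅ x ⁆ , D⊆B , wcd))
      (sym (𝟙-false (between? C (B - x) D) (λ (_ , D⊆B-x , _) → x∉p-x B x (D⊆B-x x∈D)))))
    ... | no x∉D = trans (sym (ℚ.+-identityˡ _)) (cong₂ _+_
      (sym (𝟙-false (between? (C ∪ ⁅ x ⁆) B D) (λ (Cx⊆D , _) → x∉D (Cx⊆D (x∈p∪⁅x⁆ C)))))
      (𝟙-cong (between? C B D) (between? C (B - x) D)
        (λ (C⊆D , D⊆B , wcd) → C⊆D , p⊆q-x D⊆B x∉D , wcd)
        (λ (C⊆D , D⊆B-x , wcd) → C⊆D , p─q⊆p B ⁅ x ⁆ ∘ D⊆B-x , wcd)))

  -- Every step of the path ends in `D`, hence in `B`, where `C` is closed under taking neighbours.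
  closed⇒reachable∈ : D ⊆ B → (∀ {u v} → u ∈ C → v ∈ B → SymClosure Edge v u → v ∈ C) →
                      ∀ {u v} → u ∈ C → EqClosure (InducedEdge G D) u v → v ∈ C
  closed⇒reachable∈ D⊆B closed u∈C ε = u∈C
  closed⇒reachable∈ {D = D} D⊆B closed u∈C (e ◅ es) = closed⇒reachable∈ {D = D} D⊆B closed (step e) es
    where
    step : ∀ {v} → SymClosure (InducedEdge G D) _ v → v ∈ _
    -- `closed` reads the edge from the new vertex back to the old one, so the orientation tag
    -- flips.
    step (fwd (_ , v∈D , e)) = closed u∈C (D⊆B v∈D) (bwd e)
    step (bwd (v∈D , _ , e)) = closed u∈C (D⊆B v∈D) (fwd e)

  -- Rooting at the neighbour `j` of `x` reaches the old vertices inside `C` and `x` by one edge.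
  connected-∪⁅x⁆ : WeaklyConnected G C → (∃ λ j → j ∈ C × SymClosure Edge x j) → WeaklyConnected G (C ∪ ⁅ x ⁆)
  connected-∪⁅x⁆ {C} {x} conn (j , j∈C , e) = rooted⇒connected j path
    where
    C⊆ : C ⊆ C ∪ ⁅ x ⁆
    C⊆ = p⊆p∪q ⁅ x ⁆
    path : ∀ {i} → i ∈ C ∪ ⁅ x ⁆ → EqClosure (InducedEdge G (C ∪ ⁅ x ⁆)) j i
    path i∈ with x∈p∪q⁻ C ⁅ x ⁆ i∈
    ... | inj₁ i∈C = connected-mono C⊆ (conn j _ j∈C i∈C)
    ... | inj₂ i∈x with refl ← x∈⁅y⁆⇒x≡y x i∈x =
      induce (C⊆ j∈C) i∈ (SymClosure.symmetric Edge e) ◅ ε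

  -- Branch on a neighbour x of C in B: the members containing x lie between
  -- C ∪ ⁅ x ⁆ and B, the others between C and B - x, where x stays dominated.
  -- If there is no such x, then C is closed in B, so a connected member equals
  -- C and fails to dominate B.
  ∑-between-≢ : ∀ m → Nonempty C → WeaklyConnected G C → C ⊆ B → Dominates C B →
                ∣ B ∣ ≡ suc m ℕ.+ ∣ C ∣ → ∑-between C B ≡ 0ℚ
  ∑-between-≢ {C} {B} m (c , c∈C) conn C⊆B dom ∣B∣
    with any? (λ x → x ∈? B ×-dec ¬? (x ∈? C) ×-dec any? (λ j → j ∈? C ×-dec symClosure? edge? x j))
  ... | no ∄x = ∑-zero (subsets N) λ D →
    trans (cong (_* sgn D) (𝟙-false (between? C B D) (none D))) (ℚ.*-zeroˡ (sgn D))
    where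
    closed : ∀ {u v} → u ∈ C → v ∈ B → SymClosure Edge v u → v ∈ C
    closed {u} {v} u∈C v∈B e with v ∈? C
    ... | yes v∈C = v∈C
    ... | no  v∉C = contradiction (v , v∈B , v∉C , u , u∈C , e) ∄x
    none : ∀ D → ¬ (C ⊆ D × D ⊆ B × IsWeaklyConnectedDominating G D)
    none D (C⊆D , D⊆B , _ , connD , eq) = ℕ.<⇒≱ (ℕ.m<n+m ∣ C ∣ {suc m} ℕ.z<s)
      (subst (_≤ ∣ C ∣) ∣B∣ (p⊆q⇒∣p∣≤∣q∣ B⊆C))
      where
      D⊆C : D ⊆ C
      D⊆C v∈D = closed⇒reachable∈ {D = D} D⊆B closed c∈C (connD c _ (C⊆D c∈C) v∈D)
      -- A vertex of `B` outside `D` has a neighbour in `D`, thus in `C`, and closedness absorbs it.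
      -- This contradicts that `B` has more elements than `C`.
      B⊆C : B ⊆ C
      B⊆C {v} v∈B with v ∈? D
      ... | yes v∈D = D⊆C v∈D
      ... | no  v∉D = let u , u∈D , e = dominating⁻ eq v∉D in closed (D⊆C u∈D) v∈B e
  ... | yes (x , x∈B , x∉C , nb) = trans (∑-between-split x∉C x∈B) (cancel m ∣B∣)
    where
    Cx = C ∪ ⁅ x ⁆
    neCx : Nonempty Cx
    neCx = x , x∈p∪⁅x⁆ C
    connCx : WeaklyConnected G Cx
    connCx = connected-∪⁅x⁆ conn nb
    Cx⊆B : Cx ⊆ B
    Cx⊆B = p∪⁅x⁆⊆q C⊆B x∈B
    domCx : Dominates Cx B
    domCx v∉B = let j , j∈C , e = dom v∉B in j , p⊆p∪q ⁅ x ⁆ j∈C , e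
    C⊆B-x : C ⊆ B - x
    C⊆B-x = p⊆q-x C⊆B x∉C
    domB-x : Dominates C (B - x)
    domB-x {v} v∉B-x with v ≟ x
    ... | yes refl = nb
    ... | no  v≢x  = dom (λ v∈B → v∉B-x (x∈p∧x≢y⇒x∈p-y v∈B v≢x))
    ∣Cx∣ : ∣ Cx ∣ ≡ suc ∣ C ∣
    ∣Cx∣ = ∣p∪⁅x⁆∣ C x∉C
    cancel : ∀ m → ∣ B ∣ ≡ suc m ℕ.+ ∣ C ∣ → ∑-between Cx B + ∑-between C (B - x) ≡ 0ℚ
    -- Here `x` is the only vertex of `B` outside `C`. Each interval shrinks to one weakly connected
    -- dominating set, `B` or `C`, and their signs are opposite.
    cancel zero ∣B∣ = begin
      ∑-between Cx B + ∑-between C (B - x)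
        ≡⟨ cong₂ (λ S T → ∑-between Cx S + ∑-between C T) (sym Cx≡B) (sym C≡B-x) ⟩
      ∑-between Cx Cx + ∑-between C C
        ≡⟨ cong₂ _+_
             (∑-between-≡ (neCx , connCx , dominating⁺ (subst (Dominates Cx) (sym Cx≡B) domCx)))
             (∑-between-≡ ((c , c∈C) , conn , dominating⁺ (subst (Dominates C) (sym C≡B-x) domB-x))) ⟩
      -1^ (N ∸ ∣ Cx ∣) + -1^ (N ∸ ∣ C ∣)
        ≡⟨ cong₂ (λ a b → -1^ (N ∸ a) + -1^ b) ∣Cx∣ N∸∣C∣ ⟩
      -1^ (N ∸ suc ∣ C ∣) + -1^ (suc (N ∸ suc ∣ C ∣))
        ≡⟨ -1^suc+ (N ∸ suc ∣ C ∣) ⟩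
      0ℚ ∎
      where
      Cx≡B : Cx ≡ B
      Cx≡B = ⊆∧≥⇒≡ Cx⊆B (ℕ.≤-reflexive (trans ∣B∣ (sym ∣Cx∣)))
      C≡B-x : C ≡ B - x
      C≡B-x = ⊆∧≥⇒≡ C⊆B-x (ℕ.≤-reflexive (ℕ.suc-injective (trans (suc∣p-x∣ x∈B) ∣B∣)))
      N∸∣C∣ : N ∸ ∣ C ∣ ≡ suc (N ∸ suc ∣ C ∣)
      -- The truncated subtraction is harmless because `∣ C ∣` is below `N`: the larger set `Cx`
      -- still fits.
      N∸∣C∣ = ℕ.+-∸-assoc 1 {N} {suc ∣ C ∣} (subst (_≤ N) ∣Cx∣ (∣p∣≤n Cx))
    -- Adding `x` to the lower set and removing it from the upper set both narrow the gap by one, so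
    -- the two sums vanish by induction.
    cancel (suc m) ∣B∣ = cong₂ _+_
      (∑-between-≢ m neCx connCx Cx⊆B domCx
        (trans ∣B∣ (trans (sym (ℕ.+-suc (suc m) ∣ C ∣)) (cong (suc m ℕ.+_) (sym ∣Cx∣)))))
      (∑-between-≢ m (c , c∈C) conn C⊆B-x domB-x (ℕ.suc-injective (trans (suc∣p-x∣ x∈B) ∣B∣)))

-- Vertex sets of walks

last≡lookup : ∀ {X : Set} {k} (v : Vec X (suc k)) → last v ≡ lookup v (fromℕ k)
last≡lookup {k = zero}  (x ∷ []) = refl
last≡lookup {k = suc k} (x ∷ v)  = last≡lookup v

last∈ : ∀ {X : Set} {k} (v : Vec X (suc k)) → last v ∈ᵛ v
last∈ {k = k} v = subst (_∈ᵛ v) (sym (last≡lookup v)) (∈-lookup (fromℕ k) v)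

-- In a closed walk the first vertex returns as the last, so dropping it loses no vertex.
∈-drop-first : ∀ {X : Set} {k} {x y : X} {v : Vec X (suc k)} → last v ≡ x → y ∈ᵛ x ∷ v → y ∈ᵛ v
∈-drop-first {v = v} l (here refl) = subst (_∈ᵛ v) l (last∈ v)
∈-drop-first         l (there y∈v) = y∈v

module _ {n : ℕ} where

  support : ∀ {k} → Vec (Fin n) k → Subset n
  support []      = ⊥
  support (x ∷ w) = support w ∪ ⁅ x ⁆

  ∈-support⁺ : ∀ {k v} {w : Vec (Fin n) k} → v ∈ᵛ w → v ∈ support w
  ∈-support⁺ {w = _ ∷ w} (here refl) = x∈p∪⁅x⁆ (support w)
  ∈-support⁺ {w = x ∷ w} (there v∈w) = p⊆p∪q ⁅ x ⁆ (∈-support⁺ v∈w)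

  ∈-support⁻ : ∀ {k v} (w : Vec (Fin n) k) → v ∈ support w → v ∈ᵛ w
  ∈-support⁻ []      v∈ = contradiction v∈ ∉⊥
  ∈-support⁻ (x ∷ w) v∈ with x∈p∪q⁻ (support w) ⁅ x ⁆ v∈
  ... | inj₁ v∈w = there (∈-support⁻ w v∈w)
  ... | inj₂ v∈x = here (x∈⁅y⁆⇒x≡y x v∈x)

  ∣support-∷∣ : ∀ {k x} (w : Vec (Fin n) k) → x ∈ support w → ∣ support (x ∷ w) ∣ ≤ ∣ support w ∣
  ∣support-∷∣ w x∈w = p⊆q⇒∣p∣≤∣q∣ (p∪⁅x⁆⊆q id x∈w)

  ∣support∣≤ : ∀ {k} (w : Vec (Fin n) k) → ∣ support w ∣ ≤ k
  ∣support∣≤ []      = ℕ.≤-reflexive (∣⊥∣≡0 n)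
  ∣support∣≤ (x ∷ w) with x ∈? support w
  ... | yes x∈w = ℕ.m≤n⇒m≤1+n (ℕ.≤-trans (∣support-∷∣ w x∈w) (∣support∣≤ w))
  ... | no  x∉w = subst (_≤ _) (sym (∣p∪⁅x⁆∣ (support w) x∉w)) (s≤s (∣support∣≤ w))

  -- A repeated entry adds nothing to the support, which would then have fewer elements than the
  -- vector has entries.
  ∣support∣≡⇒unique : ∀ {k} (w : Vec (Fin n) k) → ∣ support w ∣ ≡ k → Unique w
  ∣support∣≡⇒unique []      eq = []
  ∣support∣≡⇒unique (x ∷ w) eq with x ∈? support w
  ... | yes x∈w = contradiction (subst (_≤ _) eq (ℕ.≤-trans (∣support-∷∣ w x∈w) (∣support∣≤ w))) (ℕ.n≮n _)
  ... | no  x∉w = lookup⁻ (λ { i refl → x∉w (∈-support⁺ (∈-lookup i w)) }) ∷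
    ∣support∣≡⇒unique w (ℕ.suc-injective (trans (sym (∣p∪⁅x⁆∣ (support w) x∉w)) eq))

  support-⊤ : ∀ {k} {w : Vec (Fin n) k} → (∀ v → v ∈ᵛ w) → support w ≡ ⊤
  support-⊤ all = ⊆-antisym ⊆⊤ (λ {v} _ → ∈-support⁺ (all v))

  -- Pigeonhole: `n` entries covering `n` vertices leave no room for a repetition.
  covering⇒unique : (w : Vec (Fin n) n) → (∀ v → v ∈ᵛ w) → Unique w
  covering⇒unique w all = ∣support∣≡⇒unique w (trans (cong ∣_∣ (support-⊤ all)) (∣⊤∣≡n n))

unique⇒head≢last : ∀ {X : Set} {k} (w : Vec X (suc (suc k))) → Unique w → head w ≢ last w
unique⇒head≢last (x ∷ v) (x∉v ∷ _) = All.lookup x∉v (last∈ v)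

-- The total weight of a walk

module _ {N : ℕ} (G : Digraph N) where

  open Digraph G

  -- The set `S` is arbitrary because the support of the tail may be smaller, whereas the induction
  -- has to stay in one induced subgraph.
  walk-connected : ∀ {k} {w : Vec (Fin N) (suc k)} {S} → Linked Edge w → (∀ {v} → v ∈ᵛ w → v ∈ S) →
                   ∀ {v} → v ∈ᵛ w → EqClosure (InducedEdge G S) (head w) v
  walk-connected _        w⊆S (here refl) = ε
  walk-connected {w = _ ∷ y ∷ _} (e ∷ es) w⊆S (there v∈w) =
    fwd (w⊆S (here refl) , w⊆S (there (here refl)) , e) ◅ walk-connected es (w⊆S ∘ there) v∈w

  support-connected : ∀ {k} {w : Vec (Fin N) (suc k)} → Linked Edge w → WeaklyConnected G (support w)
  support-connected {w = w} es = rooted⇒connected G (head w)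
    (walk-connected es ∈-support⁺ ∘ ∈-support⁻ w)

  -- With `⊤` as upper bound, domination holds vacuously, so `∑-between-≢` covers every proper
  -- support. For a full support only `D = ⊤` remains, with sign `1ℚ`.
  ∑-between-support : ∀ {k} (w : Vec (Fin N) (suc k)) → Linked Edge w →
                      ∑-between G (support w) ⊤ ≡ 𝟙 (visitsAll? G w)
  ∑-between-support w@(x ∷ _) es = byCases (visitsAll? G w)
    where
    ⊤-dominated : ∀ {D} → Dominates G D ⊤
    ⊤-dominated v∉⊤ = contradiction ∈⊤ v∉⊤
    byCases : Dec (VisitsAll G w) → ∑-between G (support w) ⊤ ≡ 𝟙 (visitsAll? G w)
    byCases (yes all) = begin
      ∑-between G (support w) ⊤
        ≡⟨ cong (λ S → ∑-between G S ⊤) (support-⊤ {w = w} all) ⟩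
      ∑-between G ⊤ ⊤
        ≡⟨ ∑-between-≡ G ((x , ∈⊤) ,
             subst (WeaklyConnected G) (support-⊤ {w = w} all) (support-connected es) ,
             dominating⁺ G (⊤-dominated {⊤})) ⟩
      -1^ (N ∸ ∣ ⊤ {N} ∣)
        ≡⟨ cong -1^ (trans (cong (N ∸_) (∣⊤∣≡n N)) (ℕ.n∸n≡0 N)) ⟩
      1ℚ
        ≡⟨ 𝟙-true (visitsAll? G w) all ⟨
      𝟙 (visitsAll? G w) ∎
    byCases (no ¬all) = trans
      -- Some vertex is missed, so the gap `N ∸ ∣ support w ∣` is positive; the argument is this gap
      -- less one.
      (∑-between-≢ G (N ∸ suc ∣ support w ∣) (x , ∈-support⁺ {w = w} (here refl))
        (support-connected es) ⊆⊤ (⊤-dominated {support w}) (begin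
          ∣ ⊤ {N} ∣
            ≡⟨ ∣⊤∣≡n N ⟩
          N
            ≡⟨ ℕ.m∸n+n≡m (ℕ.≤∧≢⇒< (∣p∣≤n (support w)) λ eq →
                 ¬all λ v → ∈-support⁻ w (subst (v ∈_) (sym (∣p∣≡n⇒p≡⊤ eq)) ∈⊤)) ⟨
          N ∸ suc ∣ support w ∣ ℕ.+ suc ∣ support w ∣
            ≡⟨ ℕ.+-suc (N ∸ suc ∣ support w ∣) ∣ support w ∣ ⟩
          suc (N ∸ suc ∣ support w ∣) ℕ.+ ∣ support w ∣ ∎))
      (sym (𝟙-false (visitsAll? G w) ¬all))

  ∑-wcds-adjacencyOn-^ᴹ : ∀ k i j →
    ∑ (weaklyConnectedDominatingSets G) (λ D → sgn D * (adjacencyOn G D ^ᴹ suc k) i j) ≡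
    ∑ (vectors (allFin N) (suc (suc k))) (λ w → 𝟙 (isWalk? G i j w ×-dec visitsAll? G w))
  ∑-wcds-adjacencyOn-^ᴹ k i j = begin
    ∑ (weaklyConnectedDominatingSets G) (λ D → sgn D * (adjacencyOn G D ^ᴹ suc k) i j)
      ≡⟨ ∑-filter (isWeaklyConnectedDominating? G) (subsets N) _ ⟩
    ∑ (subsets N) (λ D → wcds D * (sgn D * (adjacencyOn G D ^ᴹ suc k) i j))
      ≡⟨ ∑-cong (subsets N) expand ⟩
    ∑ (subsets N) (λ D → ∑ ws (λ w → walk w * (wcds D * (sgn D * within D w))))
      ≡⟨ ∑-swap (subsets N) ws _ ⟩
    ∑ ws (λ w → ∑ (subsets N) (λ D → walk w * (wcds D * (sgn D * within D w))))
      ≡⟨ ∑-cong ws (λ w → trans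
           (∑-*ˡ (subsets N) (walk w) (λ D → wcds D * (sgn D * within D w)))
           (trans
             -- The inner sum is known only for genuine walks, whose edges `es` make the support
             -- weakly connected.
             (𝟙-*-cong (isWalk? G i j w) (λ (_ , _ , es) → trans
               (∑-cong (subsets N) (collect w)) (∑-between-support w es)))
             (sym (𝟙-× (isWalk? G i j w) (visitsAll? G w))))) ⟩
    ∑ ws (λ w → 𝟙 (isWalk? G i j w ×-dec visitsAll? G w)) ∎
    where
    ws = vectors (allFin N) (suc (suc k))
    wcds : Subset N → ℚ
    wcds D = 𝟙 (isWeaklyConnectedDominating? G D)
    walk : Vec (Fin N) (suc (suc k)) → ℚ
    walk w = 𝟙 (isWalk? G i j w)
    within : Subset N → Vec (Fin N) (suc (suc k)) → ℚ
    within D w = 𝟙 (All.all? (_∈? D) w)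

    expand : ∀ D → wcds D * (sgn D * (adjacencyOn G D ^ᴹ suc k) i j) ≡
                   ∑ ws (λ w → walk w * (wcds D * (sgn D * within D w)))
    expand D = begin
      wcds D * (sgn D * (adjacencyOn G D ^ᴹ suc k) i j)
        ≡⟨ cong (λ a → wcds D * (sgn D * a)) (adjacencyOn-^ᴹ G D k i j) ⟩
      wcds D * (sgn D * ∑ ws (λ w → walk w * within D w))
        ≡⟨ ℚ.*-assoc (wcds D) (sgn D) _ ⟨
      wcds D * sgn D * ∑ ws (λ w → walk w * within D w)
        ≡⟨ ∑-*ˡ ws (wcds D * sgn D) _ ⟨
      ∑ ws (λ w → wcds D * sgn D * (walk w * within D w))
        ≡⟨ ∑-cong ws (λ w → trans (*-swapˡ (wcds D * sgn D) (walk w) (within D w))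
             (cong (walk w *_) (ℚ.*-assoc (wcds D) (sgn D) (within D w)))) ⟩
      ∑ ws (λ w → walk w * (wcds D * (sgn D * within D w))) ∎

    collect : ∀ w D → wcds D * (sgn D * within D w) ≡ 𝟙 (between? G (support w) ⊤ D) * sgn D
    collect w D = begin
      wcds D * (sgn D * within D w)
        ≡⟨ *-swapˡ (wcds D) (sgn D) (within D w) ⟩
      sgn D * (wcds D * within D w)
        ≡⟨ ℚ.*-comm (sgn D) _ ⟩
      wcds D * within D w * sgn D
        ≡⟨ cong (_* sgn D) (trans
             (sym (𝟙-× (isWeaklyConnectedDominating? G D) (All.all? (_∈? D) w)))
             (𝟙-cong (isWeaklyConnectedDominating? G D ×-dec All.all? (_∈? D) w) (between? G (support w) ⊤ D)
               (λ (wcd , w∈D) → All.lookup w∈D ∘ ∈-support⁻ w , ⊆⊤ , wcd)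
               (λ (w⊆D , _ , wcd) → wcd , lookup⁻ (λ v → w⊆D (∈-support⁺ (∈-lookup v w)))))) ⟩
      𝟙 (between? G (support w) ⊤ D) * sgn D ∎

-- Rotation of closed walks

module _ {X : Set} where

  ∈-∷ʳ⁺ : ∀ {k x y} {v : Vec X k} → y ∈ᵛ x ∷ v → y ∈ᵛ v ∷ʳ x
  ∈-∷ʳ⁺ {v = []}    (here y≡x)          = here y≡x
  ∈-∷ʳ⁺ {v = z ∷ v} (here y≡x)          = there (∈-∷ʳ⁺ {v = v} (here y≡x))
  ∈-∷ʳ⁺ {v = z ∷ v} (there (here y≡z))  = here y≡z
  ∈-∷ʳ⁺ {v = z ∷ v} (there (there y∈v)) = there (∈-∷ʳ⁺ (there y∈v))

  ∈-∷ʳ⁻ : ∀ {k x y} {v : Vec X k} → y ∈ᵛ v ∷ʳ x → y ∈ᵛ x ∷ v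
  ∈-∷ʳ⁻ {v = []}    (here y≡x) = here y≡x
  ∈-∷ʳ⁻ {v = z ∷ v} (here y≡z) = there (here y≡z)
  ∈-∷ʳ⁻ {v = z ∷ v} (there y∈) with ∈-∷ʳ⁻ {v = v} y∈
  ... | here y≡x  = here y≡x
  ... | there y∈v = there (there y∈v)

  lookup-∷ʳ : ∀ {k} (v : Vec X k) x i → lookup (v ∷ʳ x) (inject₁ i) ≡ lookup v i
  lookup-∷ʳ (y ∷ v) x zero    = refl
  lookup-∷ʳ (y ∷ v) x (suc i) = lookup-∷ʳ v x i

  module _ {R : Rel X 0ℓ} where

    linked-∷ʳ⁺ : ∀ {k x} {v : Vec X (suc k)} → Linked R v → R (last v) x → Linked R (v ∷ʳ x)
    linked-∷ʳ⁺ {v = y ∷ []}    [-]      r = r ∷ [-]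
    linked-∷ʳ⁺ {v = y ∷ z ∷ v} (e ∷ es) r = e ∷ linked-∷ʳ⁺ es r

    linked-∷ʳ⁻ : ∀ {k x} {v : Vec X (suc k)} → Linked R (v ∷ʳ x) → Linked R v × R (last v) x
    linked-∷ʳ⁻ {v = y ∷ []}    (r ∷ [-]) = [-] , r
    linked-∷ʳ⁻ {v = y ∷ z ∷ v} (e ∷ es)  = let es′ , r = linked-∷ʳ⁻ es in e ∷ es′ , r

module _ {m : ℕ} (G : Digraph (suc m)) where

  open Digraph G

  private
    N = suc m
    vs = vectors (allFin N) N

  -- A Hamiltonian cycle with its repeated first vertex dropped; every rotation is again one.
  IsCyclicTour : Vec (Fin N) N → Set
  IsCyclicTour v = Linked Edge (last v ∷ v) × VisitsAll G v

  isCyclicTour? : ∀ v → Dec (IsCyclicTour v)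
  isCyclicTour? v = linked? edge? (last v ∷ v) ×-dec visitsAll? G v

  #toursAt : Fin N → Fin N → ℚ
  #toursAt p j = ∑ vs (λ v → 𝟙 (isCyclicTour? v) * 𝟙 (lookup v p ≟ j))

  -- The edge `e` that closes the cycle into `x` moves from the front of the walk to its end; the
  -- other edges stay in place.
  rotate⁺ : ∀ x v → IsCyclicTour (x ∷ v) → IsCyclicTour (v ∷ʳ x)
  rotate⁺ x v (e ∷ es , all) =
    subst (λ y → Linked Edge (y ∷ (v ∷ʳ x))) (sym (last-∷ʳ x v)) (linked-∷ʳ⁺ es e) ,
    λ y → ∈-∷ʳ⁺ (all y)

  rotate⁻ : ∀ x v → IsCyclicTour (v ∷ʳ x) → IsCyclicTour (x ∷ v)
  rotate⁻ x v (es , all) =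
    let es′ , e = linked-∷ʳ⁻ {v = x ∷ v} (subst (λ y → Linked Edge (y ∷ (v ∷ʳ x))) (last-∷ʳ x v) es)
    in e ∷ es′ , λ y → ∈-∷ʳ⁻ (all y)

  -- Rotation moves position `suc p` to `inject₁ p`. The tours are enumerated by their first entry
  -- on one side and by their last entry on the other.
  #toursAt-suc : ∀ p j → #toursAt (suc p) j ≡ #toursAt (inject₁ p) j
  #toursAt-suc p j = begin
    #toursAt (suc p) j
      ≡⟨ ∑-vectors (allFin N) m _ ⟩
    ∑ (allFin N) (λ x → ∑ (vectors (allFin N) m) (λ v →
      𝟙 (isCyclicTour? (x ∷ v)) * 𝟙 (lookup v p ≟ j)))
      ≡⟨ ∑-cong (allFin N) (λ x → ∑-cong (vectors (allFin N) m) (λ v → cong₂ _*_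
           (𝟙-cong (isCyclicTour? (x ∷ v)) (isCyclicTour? (v ∷ʳ x)) (rotate⁺ x v) (rotate⁻ x v))
           (cong (λ y → 𝟙 (y ≟ j)) (sym (lookup-∷ʳ v x p))))) ⟩
    ∑ (allFin N) (λ x → ∑ (vectors (allFin N) m) (λ v →
      𝟙 (isCyclicTour? (v ∷ʳ x)) * 𝟙 (lookup (v ∷ʳ x) (inject₁ p) ≟ j)))
      ≡⟨ ∑-vectors-∷ʳ (allFin N) m _ ⟨
    #toursAt (inject₁ p) j ∎

  #toursAt-const : ∀ p q j → #toursAt p j ≡ #toursAt q j
  #toursAt-const p q j = trans (from-zero p) (sym (from-zero q))
    where
    from-zero : ∀ p → #toursAt p j ≡ #toursAt zero j
    from-zero = <-weakInduction (λ p → #toursAt p j ≡ #toursAt zero j) refl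
      (λ p ih → trans (#toursAt-suc p j) ih)

  -- A tour meets `j` at exactly one position: it covers `j`, and `N` entries covering `N` vertices
  -- are distinct.
  ∑-#toursAt-position : ∀ j → ∑ (allFin N) (λ p → #toursAt p j) ≡ ∑ vs (λ v → 𝟙 (isCyclicTour? v))
  ∑-#toursAt-position j = begin
    ∑ (allFin N) (λ p → ∑ vs (λ v → 𝟙 (isCyclicTour? v) * 𝟙 (lookup v p ≟ j)))
      ≡⟨ ∑-swap (allFin N) vs _ ⟩
    ∑ vs (λ v → ∑ (allFin N) (λ p → 𝟙 (isCyclicTour? v) * 𝟙 (lookup v p ≟ j)))
      ≡⟨ ∑-cong vs (λ v → trans (∑-*ˡ (allFin N) (𝟙 (isCyclicTour? v)) _)
           (trans (𝟙-*-cong (isCyclicTour? v) (λ (_ , all) → once v all)) (ℚ.*-identityʳ _))) ⟩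
    ∑ vs (λ v → 𝟙 (isCyclicTour? v)) ∎
    where
    once : ∀ v → VisitsAll G v → ∑ (allFin N) (λ p → 𝟙 (lookup v p ≟ j)) ≡ 1ℚ
    once v all = trans
      (∑-cong (allFin N) (λ p → trans
        (𝟙-cong (lookup v p ≟ j) (p ≟ Any.index (all j))
          (λ eq → lookup-injective (covering⇒unique v all) p _ (trans eq j≡))
          (λ { refl → sym j≡ }))
        (sym (ℚ.*-identityʳ _))))
      (∑-allFin-≟ (Any.index (all j)) (λ _ → 1ℚ))
      where
      j≡ : j ≡ lookup v (Any.index (all j))
      j≡ = lookup-index (all j)

  #closedTours : Fin N → ℚ
  #closedTours i = ∑ (vectors (allFin N) (suc N)) (λ w → 𝟙 (isWalk? G i i w ×-dec visitsAll? G w))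

  -- Dropping the first vertex of a closed walk at `i` leaves a tour with `i` in its last position,
  -- `fromℕ m`, and this can be undone.
  #closedTours-≡ : ∀ i → #closedTours i ≡ #toursAt (fromℕ m) i
  #closedTours-≡ i = begin
    #closedTours i
      ≡⟨ ∑-vectors (allFin N) N _ ⟩
    ∑ (allFin N) (λ x → ∑ vs (λ v → 𝟙 (isWalk? G i i (x ∷ v) ×-dec visitsAll? G (x ∷ v))))
      ≡⟨ ∑-cong (allFin N) (λ x → trans (∑-cong vs (close x)) (∑-*ˡ vs (𝟙 (x ≟ i)) _)) ⟩
    ∑ (allFin N) (λ x → 𝟙 (x ≟ i) * #toursAt (fromℕ m) i)
      ≡⟨ ∑-allFin-≟ i (λ _ → #toursAt (fromℕ m) i) ⟩
    #toursAt (fromℕ m) i ∎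
    where
    close : ∀ x v → 𝟙 (isWalk? G i i (x ∷ v) ×-dec visitsAll? G (x ∷ v)) ≡
                    𝟙 (x ≟ i) * (𝟙 (isCyclicTour? v) * 𝟙 (lookup v (fromℕ m) ≟ i))
    close x v = begin
      𝟙 (isWalk? G i i (x ∷ v) ×-dec visitsAll? G (x ∷ v))
        ≡⟨ 𝟙-cong (isWalk? G i i (x ∷ v) ×-dec visitsAll? G (x ∷ v))
             (x ≟ i ×-dec isCyclicTour? v ×-dec lookup v (fromℕ m) ≟ i) drop-first add-first ⟩
      𝟙 (x ≟ i ×-dec isCyclicTour? v ×-dec lookup v (fromℕ m) ≟ i)
        ≡⟨ 𝟙-× (x ≟ i) (isCyclicTour? v ×-dec lookup v (fromℕ m) ≟ i) ⟩
      𝟙 (x ≟ i) * 𝟙 (isCyclicTour? v ×-dec lookup v (fromℕ m) ≟ i)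
        ≡⟨ cong (𝟙 (x ≟ i) *_) (𝟙-× (isCyclicTour? v) (lookup v (fromℕ m) ≟ i)) ⟩
      𝟙 (x ≟ i) * (𝟙 (isCyclicTour? v) * 𝟙 (lookup v (fromℕ m) ≟ i)) ∎
      where
      drop-first : IsWalk G i i (x ∷ v) × VisitsAll G (x ∷ v) →
                   x ≡ i × IsCyclicTour v × lookup v (fromℕ m) ≡ i
      drop-first ((refl , l , es) , all) =
        refl , (subst (λ y → Linked Edge (y ∷ v)) (sym l) es , ∈-drop-first l ∘ all) , trans (sym (last≡lookup v)) l
      add-first : x ≡ i × IsCyclicTour v × lookup v (fromℕ m) ≡ i →
                  IsWalk G i i (x ∷ v) × VisitsAll G (x ∷ v)
      add-first (refl , (es , all) , l) =
        (refl , trans (last≡lookup v) l , subst (λ y → Linked Edge (y ∷ v)) (trans (last≡lookup v) l) es) ,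
        there ∘ all

  -- Double counting of tours: classified by their last vertex they give the left side, classified
  -- by the position of `j` they give `N` classes, of equal size by rotation.
  ∑-#closedTours : ∀ j → ∑ (allFin N) #closedTours ≡ (+ N / 1) * #closedTours j
  ∑-#closedTours j = begin
    ∑ (allFin N) #closedTours
      ≡⟨ ∑-cong (allFin N) #closedTours-≡ ⟩
    ∑ (allFin N) (λ i → ∑ vs (λ v → 𝟙 (isCyclicTour? v) * 𝟙 (lookup v (fromℕ m) ≟ i)))
      ≡⟨ ∑-swap (allFin N) vs _ ⟩
    ∑ vs (λ v → ∑ (allFin N) (λ i → 𝟙 (isCyclicTour? v) * 𝟙 (lookup v (fromℕ m) ≟ i)))
      ≡⟨ ∑-cong vs (λ v → trans
           (∑-cong (allFin N) (λ i → trans (ℚ.*-comm (𝟙 (isCyclicTour? v)) _)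
             (cong (_* 𝟙 (isCyclicTour? v))
               (𝟙-cong (lookup v (fromℕ m) ≟ i) (i ≟ lookup v (fromℕ m)) sym sym))))
           (∑-allFin-≟ (lookup v (fromℕ m)) (λ _ → 𝟙 (isCyclicTour? v)))) ⟩
    ∑ vs (λ v → 𝟙 (isCyclicTour? v))
      ≡⟨ ∑-#toursAt-position j ⟨
    ∑ (allFin N) (λ p → #toursAt p j)
      ≡⟨ ∑-cong (allFin N) (λ p → trans (#toursAt-const p (fromℕ m) j) (sym (#closedTours-≡ j))) ⟩
    ∑ (allFin N) (λ _ → #closedTours j)
      ≡⟨ ∑-const N (#closedTours j) ⟩
    (+ N / 1) * #closedTours j ∎

  -- Hamiltonian paths and cycles as covering walks

  #hamiltonianCycles-≡ : ∀ i → + #hamiltonianCycles G i / 1 ≡ #closedTours i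
  #hamiltonianCycles-≡ i = trans
    (length-filter (isHamiltonianCycle? G i) (vectors (allFin N) (suc N)))
    (∑-cong (vectors (allFin N) (suc N)) λ w →
      𝟙-cong (isHamiltonianCycle? G i w) (isWalk? G i i w ×-dec visitsAll? G w)
        (λ (walk , _ , all) → walk , all)
        (λ (walk , all) → walk , tail-unique w walk all , all))
    where
    -- The tail has `N` entries and still covers every vertex, so its entries are distinct.
    tail-unique : ∀ w → IsWalk G i i w → VisitsAll G w → Unique (tail w)
    tail-unique (x ∷ v) (refl , l , _) all = covering⇒unique v (∈-drop-first l ∘ all)

  #coveringWalks : Fin N → Fin N → ℚ
  #coveringWalks i j = ∑ (vectors (allFin N) N) (λ w → 𝟙 (isWalk? G i j w ×-dec visitsAll? G w))

  #hamiltonianPaths-≡ : ∀ i j → + #hamiltonianPaths G i j / 1 ≡ #coveringWalks i j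
  #hamiltonianPaths-≡ i j = trans
    (length-filter (isHamiltonianPath? G i j) vs)
    (∑-cong vs λ w →
      𝟙-cong (isHamiltonianPath? G i j w) (isWalk? G i j w ×-dec visitsAll? G w)
        (λ (walk , _ , all) → walk , all)
        (λ (walk , all) → walk , covering⇒unique w all , all))

-- A covering walk with `N` entries has distinct vertices, hence distinct ends once there are two of
-- them. On a single vertex the walk of length 0 would be counted.
#coveringWalks-closed : ∀ {m} (G : Digraph (suc (suc m))) i → #coveringWalks G i i ≡ 0ℚ
#coveringWalks-closed {m} G i = ∑-zero (vectors (allFin (suc (suc m))) (suc (suc m))) λ w →
  𝟙-false (isWalk? G i i w ×-dec visitsAll? G w) λ ((h , l , _) , all) →
    unique⇒head≢last w (covering⇒unique w all) (trans h (sym l))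

H-diagonal : ∀ {m} (G : Digraph (suc m)) i → H G i i ≡ #closedTours G i
H-diagonal G i = trans
  (cong (λ b → + (if b then #hamiltonianCycles G i else #hamiltonianPaths G i i) / 1) (dec-true (i ≟ i) refl))
  (#hamiltonianCycles-≡ G i)

H-offDiagonal : ∀ {m} (G : Digraph (suc m)) {i j} → i ≢ j → H G i j ≡ #coveringWalks G i j
H-offDiagonal G {i} {j} i≢j = trans
  (cong (λ b → + (if b then #hamiltonianCycles G i else #hamiltonianPaths G i j) / 1) (dec-false (i ≟ j) i≢j))
  (#hamiltonianPaths-≡ G i j)

-- The bound `2 ≤ N` excludes a genuine exception: for `N = 1` the power `A ^ᴹ 0 = I` counts the
-- empty path, which `H` does not, and the right side exceeds the left by one.
corollary1 : (N : ℕ) .{{_ : NonZero N}} → 2 ≤ N → (G : Digraph N) → (i j : Fin N) →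
    H G i j ≡
    (Σᴹ[ D ∈ weaklyConnectedDominatingSets G ]
    ((- 1ℚ) ^ (N ∸ ∣ D ∣)) ·ᴹ
    (adjacencyOn G D ^ᴹ (N ∸ 1) +ᴹ (Tr (adjacencyOn G D ^ᴹ N) * (+ 1 / N)) ·ᴹ I)) i j
corollary1 N@(suc (suc m)) (s≤s (s≤s _)) G i j = sym (begin
  (Σᴹ[ D ∈ 𝒟 ] sgn D ·ᴹ (A D ^ᴹ suc m +ᴹ (Tr (A D ^ᴹ N) * c) ·ᴹ I)) i j
    ≡⟨ Σᴹ-∑ 𝒟 (λ D → sgn D ·ᴹ (A D ^ᴹ suc m +ᴹ (Tr (A D ^ᴹ N) * c) ·ᴹ I)) i j ⟩
  ∑ 𝒟 (λ D → sgn D * ((A D ^ᴹ suc m) i j + Tr (A D ^ᴹ N) * c * I i j))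
    ≡⟨ ∑-cong 𝒟 distribute ⟩
  ∑ 𝒟 (λ D → sgn D * (A D ^ᴹ suc m) i j + sgn D * Tr (A D ^ᴹ N) * (c * I i j))
    ≡⟨ ∑-+ 𝒟 (λ D → sgn D * (A D ^ᴹ suc m) i j) (λ D → sgn D * Tr (A D ^ᴹ N) * (c * I i j)) ⟩
  ∑ 𝒟 (λ D → sgn D * (A D ^ᴹ suc m) i j) + ∑ 𝒟 (λ D → sgn D * Tr (A D ^ᴹ N) * (c * I i j))
    ≡⟨ cong₂ _+_ (∑-wcds-adjacencyOn-^ᴹ G m i j)
         (trans (∑-*ʳ 𝒟 (λ D → sgn D * Tr (A D ^ᴹ N)) (c * I i j)) (cong (_* (c * I i j)) traces)) ⟩
  #coveringWalks G i j + (+ N / 1) * #closedTours G j * (c * I i j)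
    ≡⟨ byCases (i ≟ j) ⟩
  H G i j ∎)
  where
  𝒟 = weaklyConnectedDominatingSets G
  A = adjacencyOn G
  c = + 1 / N

  distribute : ∀ D → sgn D * ((A D ^ᴹ suc m) i j + Tr (A D ^ᴹ N) * c * I i j) ≡
                     sgn D * (A D ^ᴹ suc m) i j + sgn D * Tr (A D ^ᴹ N) * (c * I i j)
  distribute D = trans (ℚ.*-distribˡ-+ (sgn D) ((A D ^ᴹ suc m) i j) (Tr (A D ^ᴹ N) * c * I i j))
    (cong (_+_ (sgn D * (A D ^ᴹ suc m) i j)) (trans
      (cong (sgn D *_) (ℚ.*-assoc (Tr (A D ^ᴹ N)) c (I i j)))
      (sym (ℚ.*-assoc (sgn D) (Tr (A D ^ᴹ N)) (c * I i j)))))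

  -- Any base vertex could be chosen for the closed tours. With `j`, the diagonal case yields the
  -- entry of `H` directly, and off the diagonal `I i j` removes the term.
  traces : ∑ 𝒟 (λ D → sgn D * Tr (A D ^ᴹ N)) ≡ (+ N / 1) * #closedTours G j
  traces = begin
    ∑ 𝒟 (λ D → sgn D * Tr (A D ^ᴹ N))
      ≡⟨ ∑-cong 𝒟 (λ D → trans
           (cong (sgn D *_) (sym (∑-allFin (λ l → (A D ^ᴹ N) l l))))
           (sym (∑-*ˡ (allFin N) (sgn D) (λ l → (A D ^ᴹ N) l l)))) ⟩
    ∑ 𝒟 (λ D → ∑ (allFin N) (λ l → sgn D * (A D ^ᴹ N) l l))
      ≡⟨ ∑-swap 𝒟 (allFin N) _ ⟩
    ∑ (allFin N) (λ l → ∑ 𝒟 (λ D → sgn D * (A D ^ᴹ N) l l))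
      ≡⟨ ∑-cong (allFin N) (λ l → ∑-wcds-adjacencyOn-^ᴹ G (suc m) l l) ⟩
    ∑ (allFin N) (#closedTours G)
      ≡⟨ ∑-#closedTours G j ⟩
    (+ N / 1) * #closedTours G j ∎

  byCases : Dec (i ≡ j) → #coveringWalks G i j + (+ N / 1) * #closedTours G j * (c * I i j) ≡ H G i j
  byCases (yes refl) = begin
    #coveringWalks G i i + (+ N / 1) * #closedTours G i * (c * I i i)
      ≡⟨ cong₂ (λ a b → a + (+ N / 1) * #closedTours G i * (c * b))
           (#coveringWalks-closed G i) (𝟙-true (i ≟ i) refl) ⟩
    0ℚ + (+ N / 1) * #closedTours G i * (c * 1ℚ)
      ≡⟨ ℚ.+-identityˡ _ ⟩
    (+ N / 1) * #closedTours G i * (c * 1ℚ)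
      ≡⟨ cong₂ _*_ (ℚ.*-comm (+ N / 1) (#closedTours G i)) (ℚ.*-identityʳ c) ⟩
    #closedTours G i * (+ N / 1) * c
      ≡⟨ ℚ.*-assoc (#closedTours G i) (+ N / 1) c ⟩
    #closedTours G i * ((+ N / 1) * c)
      ≡⟨ cong (#closedTours G i *_) (*-inverse-/ (suc m)) ⟩
    #closedTours G i * 1ℚ
      ≡⟨ ℚ.*-identityʳ _ ⟩
    #closedTours G i
      ≡⟨ H-diagonal G i ⟨
    H G i i ∎
  byCases (no i≢j) = begin
    #coveringWalks G i j + (+ N / 1) * #closedTours G j * (c * I i j)
      ≡⟨ cong (λ b → #coveringWalks G i j + (+ N / 1) * #closedTours G j * (c * b)) (𝟙-false (i ≟ j) i≢j) ⟩
    #coveringWalks G i j + (+ N / 1) * #closedTours G j * (c * 0ℚ)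
      ≡⟨ cong (_+_ (#coveringWalks G i j)) (trans
           (cong ((+ N / 1) * #closedTours G j *_) (ℚ.*-zeroʳ c)) (ℚ.*-zeroʳ ((+ N / 1) * #closedTours G j))) ⟩
    #coveringWalks G i j + 0ℚ
      ≡⟨ ℚ.+-identityʳ _ ⟩
    #coveringWalks G i j
      ≡⟨ H-offDiagonal G i≢j ⟨
    H G i j ∎
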